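{- Let $n\ge 1$ and let $x_1,\dots,x_n,y_1,\dots,y_n$ be commuting indeterminates. Then $$\sum_{\pi \in \mathfrak{D}_n} (-1)^{\mathrm{inv}(\pi)}\, \mathbf{x}_{\mathrm{RLMv}(\pi)}\, \mathbf{y}_{\mathrm{EXCv}(\pi)} = (-1)^{n-1} \sum_{j=1}^{n-1} x_1 \cdots x_j \cdot y_{j+1}\cdots y_{n}.$$ Moreover, $$\sum_{\pi \in \mathfrak{D}_n} (-1)^{\mathrm{inv}(\pi)}\, \mathbf{x}_{\mathrm{RLMi}(\pi)}\, \mathbf{y}_{\mathrm{EXCi}(\pi)} = (-1)^{n-1} \sum_{j=1}^{n-1} y_1 \cdots y_j \cdot x_{j+1}\cdots x_{n}.$$
   Context: $[n]=\{1,\dots,n\}$; $\mathfrak{S}_n$ is the symmetric group on $[n]$; $\mathfrak{D}_n$ is the set of derangements, i.e. permutations $\pi\in\mathfrak{S}_n$ with $\pi(i)\neq i$ for all $i$. For $\pi\in\mathfrak{S}_n$: $\mathrm{inv}(\pi)$ is the number of pairs $i<j$ with $\pi(i)>\pi(j)$; $\mathrm{EXCi}(\pi)=\{j\in[n]:\pi(j)>j\}$; $\mathrm{EXCv}(\pi)=\{\pi(j):j\in\mathrm{EXCi}(\pi)\}$; $\mathrm{RLMi}(\pi)=\{i\in[n]:\pi(i)<\pi(j)\text{ for all }j\in\{i+1,\dots,n\}\}$; $\mathrm{RLMv}(\pi)=\{\pi(i):i\in\mathrm{RLMi}(\pi)\}$. For a finite set $S$ of positive integers, $\mathbf{x}_S=\prod_{s\in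 S}x_s$ and $\mathbf{y}_S=\prod_{s\in S}y_s$, with $\mathbf{x}_\emptyset=\mathbf{y}_\emptyset=1$. -}

module Defs where

open import Algebra.Bundles using (CommutativeRing)
import Algebra.Properties.Semiring.Exp as Exp
open import Data.Fin using (Fin; zero; suc; toℕ; _<_; punchIn; _≟_)
open import Data.Fin.Permutation as Perm
  using (Permutation′; _⟨$⟩ʳ_; insert; remove; insert-punchIn; insert-remove)
open import Data.Fin.Properties using (_<?_; all?; punchIn-injective)
open import Data.List
  using (List; []; _∷_; [_]; map; foldr; filter; length; allFin; upTo;
         cartesianProduct; cartesianProductWith)
open import Data.List.Membership.Propositional.Properties using (∈-allFin)
import Data.List.Membership.Setoid as SetoidMembership
import Data.List.Membership.Setoid.Properties as SetoidMembershipₚ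
open import Data.List.Relation.Unary.All using ([])
open import Data.List.Relation.Unary.Any using (here)
open import Data.List.Relation.Unary.AllPairs using ([]; _∷_)
import Data.List.Relation.Unary.Unique.Propositional as Unique≡
import Data.List.Relation.Unary.Unique.Propositional.Properties as Unique≡ₚ
import Data.List.Relation.Unary.Unique.Setoid as SetoidUnique
import Data.List.Relation.Unary.Unique.Setoid.Properties as SetoidUniqueₚ
open import Data.Nat as ℕ using (ℕ; zero; suc)
open import Data.Product using (_×_; _,_; uncurry)
open import Function.Bundles using (Injection)
open import Function.Properties.Inverse using (↔⇒↣)
open import Level using (0ℓ)
open import Relation.Binary using (Setoid)
open import Relation.Binary.PropositionalEquality
  using (_≡_; _≢_; refl; sym; trans; cong; setoid)
open import Relation.Nullary using (yes; no; ¬?; _×-dec_; _→-dec_)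
open import Relation.Unary using (Decidable)

private
  variable
    n : ℕ

-- The set [n] is represented by Fin n, so that i : Fin n stands for the
-- positive integer toℕ i + 1.  Finite sets are represented by
-- duplicate-free lists.

-- A permutation of Fin (suc n) is the image of zero together with a
-- permutation of the remaining n points; completeness and absence of
-- repetitions are proved at the end of the file.
permutations : ∀ n → List (Permutation′ n)
permutations zero    = [ Perm.id ]
permutations (suc n) = cartesianProductWith (insert zero) (allFin (suc n)) (permutations n)

Derangement : Permutation′ n → Set
Derangement π = ∀ i → π ⟨$⟩ʳ i ≢ i

derangement? : Decidable (Derangement {n})
derangement? π = all? λ i → ¬? (π ⟨$⟩ʳ i ≟ i)

derangements : ∀ n → List (Permutation′ n)
derangements n = filter derangement? (permutations n)

inversion? : (π : Permutation′ n) →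
             Decidable (uncurry λ i j → i < j × π ⟨$⟩ʳ j < π ⟨$⟩ʳ i)
inversion? π (i , j) = (i <? j) ×-dec (π ⟨$⟩ʳ j <? π ⟨$⟩ʳ i)

inv : Permutation′ n → ℕ
inv {n} π = length (filter (inversion? π) (cartesianProduct (allFin n) (allFin n)))

EXCi : Permutation′ n → List (Fin n)
EXCi {n} π = filter (λ j → j <? π ⟨$⟩ʳ j) (allFin n)

EXCv : Permutation′ n → List (Fin n)
EXCv π = map (π ⟨$⟩ʳ_) (EXCi π)

rightToLeftMin? : (π : Permutation′ n) →
                  Decidable (λ i → ∀ j → i < j → π ⟨$⟩ʳ i < π ⟨$⟩ʳ j)
rightToLeftMin? π i = all? λ j → (i <? j) →-dec (π ⟨$⟩ʳ i <? π ⟨$⟩ʳ j)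

RLMi : Permutation′ n → List (Fin n)
RLMi {n} π = filter (rightToLeftMin? π) (allFin n)

RLMv : Permutation′ n → List (Fin n)
RLMv π = map (π ⟨$⟩ʳ_) (RLMi π)

1⋯_ : ℕ → List ℕ
1⋯ m = map suc (upTo m)

-- {1, …, j} and {j+1, …, n} as subsets of [n]; the shift between Fin n
-- and [n] turns "at most j" into "toℕ i < j".
atMost above : ∀ n → ℕ → List (Fin n)
atMost n j = filter (λ i → toℕ i ℕ.<? j) (allFin n)
above  n j = filter (λ i → j ℕ.≤? toℕ i) (allFin n)

module Sums {c ℓ} (R : CommutativeRing c ℓ) where
  open CommutativeRing R
  open Exp semiring public using (_^_)

  sumOver productOver : ∀ {a} {A : Set a} → List A → (A → Carrier) → Carrier
  sumOver     xs f = foldr _+_ 0# (map f xs)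
  productOver xs f = foldr _*_ 1# (map f xs)

  infix 5 sumOver productOver
  syntax sumOver     xs (λ x → e) = ∑[ x ← xs ] e
  syntax productOver xs (λ x → e) = ∏[ x ← xs ] e

-- Permutation′ n carries no useful propositional equality without
-- function extensionality, so permutations are compared pointwise.
≈-setoid : ℕ → Setoid 0ℓ 0ℓ
≈-setoid n = record
  { Carrier       = Permutation′ n
  ; _≈_           = Perm._≈_
  ; isEquivalence = record
    { refl  = λ _ → refl
    ; sym   = λ p i → sym (p i)
    ; trans = λ p q i → trans (p i) (q i)
    }
  }

insert-cong : ∀ (i : Fin (suc n)) {j k} (π ρ : Permutation′ n) → j ≡ k → π Perm.≈ ρ →
              insert i j π Perm.≈ insert i k ρ
insert-cong i {j} π ρ refl π≈ρ l with i ≟ l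
... | yes _   = refl
... | no  i≢l = cong (punchIn j) (π≈ρ _)

insert-injective : ∀ {j k} (π ρ : Permutation′ n) →
                   insert zero j π Perm.≈ insert zero k ρ → j ≡ k × π Perm.≈ ρ
insert-injective {j = j} π ρ eq with eq zero
... | refl = refl , λ i → punchIn-injective j _ _
  (trans (sym (insert-punchIn zero j π i))
         (trans (eq (suc i)) (insert-punchIn zero j ρ i)))

permutations-complete : (π : Permutation′ n) →
                        SetoidMembership._∈_ (≈-setoid n) π (permutations n)
permutations-complete {zero}  π = here λ ()
permutations-complete {suc n} π =
  SetoidMembershipₚ.∈-resp-≈ (≈-setoid (suc n))
    {x = insert zero (π ⟨$⟩ʳ zero) (remove zero π)} {y = π} (insert-remove zero π)
    (SetoidMembershipₚ.∈-cartesianProductWith⁺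
      (setoid (Fin (suc n))) (≈-setoid n) (≈-setoid (suc n))
      (λ {_} {_} {ρ} {σ} → insert-cong zero ρ σ)
      (∈-allFin (π ⟨$⟩ʳ zero))
      (permutations-complete (remove zero π)))

permutations-unique : ∀ n → SetoidUnique.Unique (≈-setoid n) (permutations n)
permutations-unique zero    = [] ∷ []
permutations-unique (suc n) =
  SetoidUniqueₚ.cartesianProductWith⁺
    (setoid (Fin (suc n))) (≈-setoid n) (≈-setoid (suc n)) (insert zero)
    (λ {_} {_} {ρ} {σ} → insert-injective ρ σ)
    (Unique≡ₚ.allFin⁺ (suc n))
    (permutations-unique n)

EXCv-unique : (π : Permutation′ n) → Unique≡.Unique (EXCv π)
EXCv-unique {n} π = Unique≡ₚ.map⁺ (Injection.injective (↔⇒↣ π))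
  (Unique≡ₚ.filter⁺ (λ j → j <? π ⟨$⟩ʳ j) (Unique≡ₚ.allFin⁺ n))

RLMv-unique : (π : Permutation′ n) → Unique≡.Unique (RLMv π)
RLMv-unique {n} π = Unique≡ₚ.map⁺ (Injection.injective (↔⇒↣ π))
  (Unique≡ₚ.filter⁺ (rightToLeftMin? π) (Unique≡ₚ.allFin⁺ n))

{-# OPTIONS --safe #-}

-- For the second identity, let F n be the left side and let H n be the same
-- signed sum over all permutations of n + 1 points in which the first entry
-- is unrestricted and carries weight 1.  Since the first entry is an
-- excedance in every derangement, F (n + 1) = y₁ (H n − F n), where F n and H n
-- are formed with the variables of the remaining rows.  Exchanging the first
-- two entries, or the two smallest values when one of them is the first entry,
-- cancels everything in H (n + 1) except the terms in which the second entry is the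
-- minimal value, so that H (n + 1) = − x₂ H n, H n = (−1)ⁿ x₂ ⋯ xₙ₊₁, and the
-- closed form of F follows.  Reflecting permutation matrices in the
-- antidiagonal preserves inversions and turns the values of excedances and
-- right-to-left minima into (reversed) positions, which gives the first
-- identity.

module Submission where

open import Defs
open import Algebra.Bundles using (CommutativeMonoid; CommutativeRing)
import Algebra.Properties.AbelianGroup as AbelianGroupProperties
import Algebra.Properties.CommutativeMonoid.Sum as FinSum
import Algebra.Properties.Ring as RingProperties
import Algebra.Properties.Semiring.Mult.TCOptimised as Multiples
import Algebra.Properties.Semiring.Sum as SemiringSum
import Algebra.Solver.Ring as RingSolver
open import Algebra.Solver.Ring.AlmostCommutativeRing
  using (fromCommutativeRing; _-Raw-AlmostCommutative⟶_)
open import Data.Bool using (true; false; if_then_else_; _∧_)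
open import Data.Fin
  using (Fin; zero; suc; toℕ; punchIn; inject₁; opposite; _<_; _≟_)
open import Data.Fin.Permutation as Perm
  using (Permutation′; _⟨$⟩ʳ_; _⟨$⟩ˡ_; _∘ₚ_; flip; insert; reverse)
open import Data.Fin.Properties
  using (_<?_; <-cmp; punchIn-mono-≤; punchIn-cancel-≤; toℕ-injective; toℕ<n;
         ¬∀⟶∃¬; opposite-prop; opposite-involutive)
open import Data.Integer as ℤ using (ℤ; +_; -[1+_])
import Data.Integer.Properties as ℤₚ
open import Data.List
  using (List; []; _∷_; _++_; map; foldr; filter; length; tabulate; allFin;
         upTo; applyUpTo; cartesianProduct; cartesianProductWith)
open import Data.List.Properties using (map-∘; length-map; length-removeAt)
import Data.List.Membership.Setoid as SetoidMembership
import Data.List.Membership.Setoid.Properties as SetoidMembershipₚ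
open import Data.List.Relation.Unary.AllPairs using ([]; _∷_)
open import Data.List.Relation.Unary.Any as Any using (here; there; _─_)
import Data.List.Relation.Unary.Unique.Setoid as SetoidUnique
import Data.Maybe as Maybe
open import Data.Nat as ℕ using (ℕ; zero; suc; NonZero; _<ᵇ_; _≡ᵇ_; _∸_)
import Data.Nat.Properties as ℕₚ
open import Data.Product using (_×_; _,_)
open import Function using (_∘_; id; _⇔_; mk⇔; Equivalence)
open import Level using (Level)
open import Relation.Binary using (Setoid; tri<; tri≈; tri>)
open import Relation.Binary.PropositionalEquality as ≡ using (_≡_; _≢_)
import Relation.Binary.Reasoning.Setoid as SetoidReasoning
open import Relation.Nullary using (¬_; ¬?; Dec; does; yes; no; contradiction)
open import Relation.Nullary.Decidable
  using (does-⇔; dec-true; dec-false; dec⇒maybe; decidable-stable)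
open import Relation.Unary using (Decidable)

private
  variable
    n : ℕ

-- Order and deleted points in finite ordinals.

-- When two sums agree, a strict increase in one summand must be paid for by the other. With `a` the
-- reversal of `i`, this makes reversal exchange initial and final segments.
complementary-<⇔≤ : ∀ {a i j j′} → a ℕ.+ suc i ≡ j ℕ.+ j′ → a ℕ.< j ⇔ j′ ℕ.≤ i
complementary-<⇔≤ {a} {i} {j} {j′} eq = mk⇔
  (λ a<j → ℕₚ.≮⇒≥ λ i<j′ → ℕₚ.<-irrefl eq (ℕₚ.+-mono-<-≤ a<j i<j′))
  (λ j′≤i → ℕₚ.≰⇒> λ j≤a → ℕₚ.<-irrefl (≡.sym eq) (ℕₚ.+-mono-≤-< j≤a (ℕ.s≤s j′≤i)))

-- The cosimplicial identity: both sides enumerate the columns other than `inject₁ i` and `suc j`,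
-- deleted in the two possible orders.
punchIn-inject₁ : ∀ (i j : Fin (suc n)) (l : Fin n) → toℕ i ℕ.≤ toℕ j →
                  punchIn (inject₁ i) (punchIn j l) ≡ punchIn (suc j) (punchIn i l)
punchIn-inject₁ zero    j       l       _         = ≡.refl
punchIn-inject₁ (suc i) (suc j) zero    _         = ≡.refl
punchIn-inject₁ (suc i) (suc j) (suc l) (ℕ.s≤s p) = ≡.cong suc (punchIn-inject₁ i j l p)

punchIn-<⇔ : ∀ i (j k : Fin n) → punchIn i j < punchIn i k ⇔ j < k
punchIn-<⇔ i j k = mk⇔
  (λ p → ℕₚ.≰⇒> (ℕₚ.<⇒≱ p ∘ punchIn-mono-≤ i k j))
  (λ p → ℕₚ.≰⇒> (ℕₚ.<⇒≱ p ∘ punchIn-cancel-≤ i k j))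

RightToLeftMin : Permutation′ n → Fin n → Set
RightToLeftMin π i = ∀ j → i < j → π ⟨$⟩ʳ i < π ⟨$⟩ʳ j

-- The new entry stands to the left of all others, and `punchIn c` preserves the order of the
-- remaining values.
rightToLeftMin-insert : ∀ c (π : Permutation′ n) i →
  RightToLeftMin (insert zero c π) (suc i) ⇔ RightToLeftMin π i
rightToLeftMin-insert c π i = mk⇔
  (λ m j i<j → Equivalence.to (punchIn-<⇔ c _ _) (m (suc j) (ℕ.s≤s i<j)))
  (λ { m (suc j) (ℕ.s≤s i<j) → Equivalence.from (punchIn-<⇔ c _ _) (m j i<j) })

-- Reflection of a permutation in the antidiagonal.

opposite-+ : (i : Fin n) → toℕ (opposite i) ℕ.+ suc (toℕ i) ≡ n
opposite-+ i = ≡.trans (≡.cong (ℕ._+ suc (toℕ i)) (opposite-prop i)) (ℕₚ.m∸n+n≡m (toℕ<n i))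

opposite-<⇔ : (i j : Fin n) → opposite i < opposite j ⇔ j < i
opposite-<⇔ i j = mk⇔
  (≡.subst₂ _<_ (opposite-involutive j) (opposite-involutive i) ∘ anti (opposite j) (opposite i))
  (anti i j)
  where
  anti : ∀ i j → j < i → opposite i < opposite j
  anti i j j<i = ≡.subst₂ ℕ._<_ (≡.sym (opposite-prop i)) (≡.sym (opposite-prop j))
    (ℕₚ.∸-monoʳ-< (ℕ.s≤s j<i) (toℕ<n i))

-- The inverse alone would turn excedances into deficiencies and right-to-left minima into
-- left-to-right maxima; conjugation by the reversal undoes both changes.
antitranspose : Permutation′ n → Permutation′ n
antitranspose π = reverse ∘ₚ flip π ∘ₚ reverse

antitranspose-involutive : (π : Permutation′ n) → antitranspose (antitranspose π) Perm.≈ π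
antitranspose-involutive π i =
  ≡.trans (opposite-involutive _) (≡.cong (π ⟨$⟩ʳ_) (opposite-involutive i))

-- `Perm.≈` compares forward maps, so agreement of the inverse maps has to be derived.
antitranspose-cong : (π ρ : Permutation′ n) → π Perm.≈ ρ → antitranspose π Perm.≈ antitranspose ρ
antitranspose-cong π ρ π≈ρ i = ≡.cong opposite (begin
  π ⟨$⟩ˡ j                        ≡⟨ Perm.inverseˡ ρ ⟨
  ρ ⟨$⟩ˡ (ρ ⟨$⟩ʳ (π ⟨$⟩ˡ j))      ≡⟨ ≡.cong (ρ ⟨$⟩ˡ_) (π≈ρ (π ⟨$⟩ˡ j)) ⟨
  ρ ⟨$⟩ˡ (π ⟨$⟩ʳ (π ⟨$⟩ˡ j))      ≡⟨ ≡.cong (ρ ⟨$⟩ˡ_) (Perm.inverseʳ π) ⟩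
  ρ ⟨$⟩ˡ j                        ∎)
  where
  open ≡.≡-Reasoning
  j = opposite i

-- The antitranspose sends the point (a , π a) of the graph of π to
-- (opposite (π a) , opposite a).
module Antitranspose (π : Permutation′ n) where
  -- The new position of the point at `a`. Being a permutation, it can reindex products over all
  -- positions.
  reversed : Permutation′ n
  reversed = π ∘ₚ reverse

  image : ∀ a → antitranspose π ⟨$⟩ʳ (reversed ⟨$⟩ʳ a) ≡ opposite a
  image a = ≡.cong opposite (≡.trans (≡.cong (π ⟨$⟩ˡ_) (opposite-involutive _)) (Perm.inverseˡ π))

  reversed-<⇔ : ∀ a b → reversed ⟨$⟩ʳ a < reversed ⟨$⟩ʳ b ⇔ π ⟨$⟩ʳ b < π ⟨$⟩ʳ a
  reversed-<⇔ a b = opposite-<⇔ (π ⟨$⟩ʳ a) (π ⟨$⟩ʳ b)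

  image-<⇔ : ∀ a b →
    antitranspose π ⟨$⟩ʳ (reversed ⟨$⟩ʳ a) < antitranspose π ⟨$⟩ʳ (reversed ⟨$⟩ʳ b) ⇔ b < a
  image-<⇔ a b = ≡.subst₂ (λ i j → i < j ⇔ b < a) (≡.sym (image a)) (≡.sym (image b)) (opposite-<⇔ a b)

  inversion⇔ : ∀ a b →
    (reversed ⟨$⟩ʳ a < reversed ⟨$⟩ʳ b ×
     antitranspose π ⟨$⟩ʳ (reversed ⟨$⟩ʳ b) < antitranspose π ⟨$⟩ʳ (reversed ⟨$⟩ʳ a)) ⇔
    (a < b × π ⟨$⟩ʳ b < π ⟨$⟩ʳ a)
  inversion⇔ a b = mk⇔
    (λ (p , q) → to (image-<⇔ b a) q , to (reversed-<⇔ a b) p)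
    (λ (p , q) → from (reversed-<⇔ a b) q , from (image-<⇔ b a) p)
    where open Equivalence

  -- A position fails to be a right-to-left minimum when it is the left end of an inversion, and the
  -- reflection keeps left ends of inversions. Trichotomy passes between the absence of inversions
  -- and the required inequalities.
  rightToLeftMin⇔ : ∀ a → RightToLeftMin (antitranspose π) (reversed ⟨$⟩ʳ a) ⇔ RightToLeftMin π a
  rightToLeftMin⇔ a = mk⇔ forth back
    where
    open Equivalence
    forth : RightToLeftMin (antitranspose π) (reversed ⟨$⟩ʳ a) → RightToLeftMin π a
    forth m b a<b with <-cmp (π ⟨$⟩ʳ a) (π ⟨$⟩ʳ b)
    ... | tri< πa<πb _ _ = πa<πb
    ... | tri≈ _ πa≡πb _ = contradiction a<b (ℕₚ.<-irrefl (≡.cong toℕ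
            (≡.trans (≡.sym (Perm.inverseˡ π)) (≡.trans (≡.cong (π ⟨$⟩ˡ_) πa≡πb) (Perm.inverseˡ π)))))
    ... | tri> _ _ πb<πa = contradiction a<b (ℕₚ.<-asym
            (to (image-<⇔ a b) (m (reversed ⟨$⟩ʳ b) (from (reversed-<⇔ a b) πb<πa))))

    onImage : RightToLeftMin π a → ∀ b → reversed ⟨$⟩ʳ a < reversed ⟨$⟩ʳ b →
              antitranspose π ⟨$⟩ʳ (reversed ⟨$⟩ʳ a) < antitranspose π ⟨$⟩ʳ (reversed ⟨$⟩ʳ b)
    onImage m b p with <-cmp a b
    ... | tri< a<b _ _    = contradiction (to (reversed-<⇔ a b) p) (ℕₚ.<-asym (m b a<b))
    ... | tri≈ _ ≡.refl _ = contradiction p (ℕₚ.<-irrefl ≡.refl)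
    ... | tri> _ _ b<a    = from (image-<⇔ a b) b<a

    back : RightToLeftMin π a → RightToLeftMin (antitranspose π) (reversed ⟨$⟩ʳ a)
    -- Every position `j` is `reversed ⟨$⟩ʳ b` for some `b`, so `onImage` covers all of them.
    back m j p = ≡.subst (λ k → antitranspose π ⟨$⟩ʳ (reversed ⟨$⟩ʳ a) < antitranspose π ⟨$⟩ʳ k)
      (Perm.inverseʳ reversed)
      (onImage m (reversed ⟨$⟩ˡ j) (≡.subst (reversed ⟨$⟩ʳ a <_) (≡.sym (Perm.inverseʳ reversed)) p))

-- Folds in a commutative monoid and their reindexing.

module ListFold {c ℓ} (M : CommutativeMonoid c ℓ) where
  open CommutativeMonoid M
  open FinSum M using (sum)
  open SetoidReasoning setoid

  private
    variable
      a : Level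
      A B C : Set a

  fold : List A → (A → Carrier) → Carrier
  fold xs f = foldr _∙_ ε (map f xs)

  fold-cong : ∀ (xs : List A) {f g : A → Carrier} → (∀ x → f x ≈ g x) → fold xs f ≈ fold xs g
  fold-cong []       eq = refl
  fold-cong (x ∷ xs) eq = ∙-cong (eq x) (fold-cong xs eq)

  fold-filter : ∀ {p} {P : A → Set p} (P? : Decidable P) xs f →
                fold (filter P? xs) f ≈ fold xs (λ x → if does (P? x) then f x else ε)
  fold-filter P? []       f = refl
  fold-filter P? (x ∷ xs) f with does (P? x)
  ... | true  = ∙-congˡ (fold-filter P? xs f)
  ... | false = trans (fold-filter P? xs f) (sym (identityˡ _))

  fold-++ : ∀ (xs ys : List A) f → fold (xs ++ ys) f ≈ fold xs f ∙ fold ys f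
  fold-++ []       ys f = sym (identityˡ _)
  fold-++ (x ∷ xs) ys f = trans (∙-congˡ (fold-++ xs ys f)) (sym (assoc _ _ _))

  fold-map : ∀ (g : A → B) xs f → fold (map g xs) f ≡ fold xs (f ∘ g)
  fold-map g xs f = ≡.cong (foldr _∙_ ε) (≡.sym (map-∘ xs))

  fold-cartesianProductWith : ∀ (g : A → B → C) xs ys f →
    fold (cartesianProductWith g xs ys) f ≈ fold xs (λ x → fold ys (λ y → f (g x y)))
  fold-cartesianProductWith g []       ys f = refl
  fold-cartesianProductWith g (x ∷ xs) ys f = trans (fold-++ (map (g x) ys) _ f)
    (∙-cong (reflexive (fold-map (g x) ys f)) (fold-cartesianProductWith g xs ys f))

  fold-tabulate : ∀ (g : Fin n → A) f → fold (tabulate g) f ≡ sum (f ∘ g)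
  fold-tabulate {n = zero}  g f = ≡.refl
  fold-tabulate {n = suc n} g f = ≡.cong (f (g zero) ∙_) (fold-tabulate (g ∘ suc) f)

  fold-allFin : ∀ n (f : Fin n → Carrier) → fold (allFin n) f ≡ sum f
  fold-allFin n f = fold-tabulate id f

  fold-filter-allFin : ∀ {p} {P : Fin n → Set p} (P? : Decidable P) f →
    fold (filter P? (allFin n)) f ≈ sum (λ i → if does (P? i) then f i else ε)
  fold-filter-allFin P? f = trans (fold-filter P? (allFin _) f)
    (reflexive (fold-tabulate id (λ i → if does (P? i) then f i else ε)))

  module _ {a ℓ′} (S : Setoid a ℓ′) (f : Setoid.Carrier S → Carrier)
    (f-cong : ∀ {x y} → Setoid._≈_ S x y → f x ≈ f y) where
    private module S = Setoid S
    open SetoidMembership S using (_∈_)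
    open SetoidUnique S using (Unique)

    fold-─ : ∀ {x xs} (x∈xs : x ∈ xs) → fold xs f ≈ f x ∙ fold (xs ─ x∈xs) f
    fold-─ (here x≈y)                = ∙-congʳ (sym (f-cong x≈y))
    fold-─ {x} {y ∷ xs} (there x∈xs) = trans (∙-congˡ (fold-─ x∈xs))
      (trans (sym (assoc _ _ _)) (trans (∙-congʳ (comm (f y) (f x))) (assoc _ _ _)))

    ∈-─ : ∀ {x y xs} (x∈xs : x ∈ xs) → y ∈ xs → ¬ (x S.≈ y) → y ∈ (xs ─ x∈xs)
    ∈-─ (here x≈z)   (here y≈z)   x≉y = contradiction (S.trans x≈z (S.sym y≈z)) x≉y
    ∈-─ (here x≈z)   (there y∈xs) x≉y = y∈xs
    ∈-─ (there x∈xs) (here y≈z)   x≉y = here y≈z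
    ∈-─ (there x∈xs) (there y∈xs) x≉y = there (∈-─ x∈xs y∈xs x≉y)

    -- Pigeonhole: each element of `xs` is struck out of `ys`; as `xs` has no repetitions, its later
    -- elements survive in the rest, and the equal lengths leave nothing over.
    fold-⊆ : ∀ {xs ys} → Unique xs → (∀ {x} → x ∈ xs → x ∈ ys) → length xs ≡ length ys →
             fold xs f ≈ fold ys f
    fold-⊆ {[]}     {[]} _              _     _  = refl
    fold-⊆ {x ∷ xs} {ys} (x∉xs ∷ uniq) xs⊆ys eq = trans
      (∙-congˡ (fold-⊆ uniq
        (λ y∈xs → ∈-─ x∈ys (xs⊆ys (there y∈xs))
          (λ x≈y → SetoidMembershipₚ.All[≉]⇒∉ S x∉xs (SetoidMembershipₚ.∈-resp-≈ S (S.sym x≈y) y∈xs)))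
        (≡.trans (≡.cong ℕ.pred eq) (≡.sym (length-removeAt ys (Any.index x∈ys))))))
      (sym (fold-─ x∈ys))
      where x∈ys = xs⊆ys (here S.refl)

  -- Since π agrees with `φ (φ π)`, every permutation occurs in `map φ (permutations n)`, a list of
  -- the same length, and `fold-⊆` applies.
  fold-permutations : (φ : Permutation′ n → Permutation′ n) →
    (∀ π ρ → π Perm.≈ ρ → φ π Perm.≈ φ ρ) → (∀ π → φ (φ π) Perm.≈ π) →
    (f : Permutation′ n → Carrier) → (∀ π ρ → π Perm.≈ ρ → f π ≈ f ρ) →
    fold (permutations n) f ≈ fold (permutations n) (f ∘ φ)
  fold-permutations {n} φ φ-cong φ-involutive f f-cong = trans
    (fold-⊆ (≈-setoid n) f (λ {π} {ρ} → f-cong π ρ) (permutations-unique n)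
      (λ {π} _ → SetoidMembershipₚ.∈-resp-≈ (≈-setoid n) {x = φ (φ π)} {y = π} (φ-involutive π)
        (SetoidMembershipₚ.∈-map⁺ (≈-setoid n) (≈-setoid n) (λ {π} {ρ} → φ-cong π ρ)
          (permutations-complete (φ π))))
      (≡.sym (length-map φ (permutations n))))
    (reflexive (fold-map φ (permutations n) f))

-- The ring solver cancels opposite terms only if it can decide equality
-- of coefficients, hence integer coefficients.
module IntegerCoefficients {c ℓ} (R : CommutativeRing c ℓ) where
  open CommutativeRing R hiding (zero)
  open RingProperties ring using (-0#≈0#; -‿involutive; -‿distribˡ-*; -‿distribʳ-*)
  open AbelianGroupProperties +-abelianGroup using (⁻¹-∙-comm; xyx⁻¹≈y)
  open Multiples semiring using (1+×; ×-homo-+; ×1-homo-*) renaming (_×_ to _·_)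
  open SetoidReasoning setoid

  -- The canonical ring homomorphism. With this version of multiples, `con (+ 1)` evaluates to `1#`
  -- itself, so identities obtained from `solve` have the literal form needed.
  ⟦_⟧ℤ : ℤ → Carrier
  ⟦ + n ⟧ℤ      = n · 1#
  ⟦ -[1+ n ] ⟧ℤ = - (suc n · 1#)

  neg-homo : ∀ i → ⟦ ℤ.- i ⟧ℤ ≈ - ⟦ i ⟧ℤ
  neg-homo (+ zero)   = sym -0#≈0#
  neg-homo (+ suc n)  = refl
  neg-homo -[1+ n ]   = sym (-‿involutive _)

  ⊖-homo : ∀ m n → ⟦ m ℤ.⊖ n ⟧ℤ ≈ m · 1# - n · 1#
  ⊖-homo m       zero    = sym (trans (+-congˡ -0#≈0#) (+-identityʳ _))
  ⊖-homo zero    (suc n) = sym (+-identityˡ _)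
  ⊖-homo (suc m) (suc n) = begin
    ⟦ suc m ℤ.⊖ suc n ⟧ℤ             ≡⟨ ≡.cong ⟦_⟧ℤ (ℤₚ.[1+m]⊖[1+n]≡m⊖n m n) ⟩
    ⟦ m ℤ.⊖ n ⟧ℤ                     ≈⟨ ⊖-homo m n ⟩
    m · 1# - n · 1#                  ≈⟨ +-congʳ (xyx⁻¹≈y 1# (m · 1#)) ⟨
    1# + m · 1# - 1# - n · 1#        ≈⟨ +-assoc _ _ _ ⟩
    1# + m · 1# + (- 1# - n · 1#)    ≈⟨ +-cong (sym (1+× m 1#))
                                                (trans (⁻¹-∙-comm 1# (n · 1#)) (-‿cong (sym (1+× n 1#)))) ⟩
    suc m · 1# - suc n · 1#          ∎

  +-homo : ∀ i j → ⟦ i ℤ.+ j ⟧ℤ ≈ ⟦ i ⟧ℤ + ⟦ j ⟧ℤ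
  +-homo (+ m)    (+ n)    = ×-homo-+ 1# m n
  +-homo (+ m)    -[1+ n ] = ⊖-homo m (suc n)
  +-homo -[1+ m ] (+ n)    = trans (⊖-homo n (suc m)) (+-comm _ _)
  +-homo -[1+ m ] -[1+ n ] = begin
    - (suc (suc (m ℕ.+ n)) · 1#)      ≡⟨ ≡.cong (λ k → - (k · 1#)) (ℕₚ.+-suc (suc m) n) ⟨
    - ((suc m ℕ.+ suc n) · 1#)        ≈⟨ -‿cong (×-homo-+ 1# (suc m) (suc n)) ⟩
    - (suc m · 1# + suc n · 1#)       ≈⟨ ⁻¹-∙-comm _ _ ⟨
    - (suc m · 1#) - suc n · 1#       ∎

  *-homo⁺ : ∀ m j → ⟦ + m ℤ.* j ⟧ℤ ≈ m · 1# * ⟦ j ⟧ℤ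
  *-homo⁺ m (+ n)    = trans (reflexive (≡.cong ⟦_⟧ℤ (≡.sym (ℤₚ.pos-* m n)))) (×1-homo-* m n)
  *-homo⁺ m -[1+ n ] = begin
    ⟦ + m ℤ.* -[1+ n ] ⟧ℤ       ≡⟨ ≡.cong ⟦_⟧ℤ (ℤₚ.neg-distribʳ-* (+ m) (+ suc n)) ⟨
    ⟦ ℤ.- (+ m ℤ.* + suc n) ⟧ℤ  ≈⟨ neg-homo (+ m ℤ.* + suc n) ⟩
    - ⟦ + m ℤ.* + suc n ⟧ℤ      ≈⟨ -‿cong (*-homo⁺ m (+ suc n)) ⟩
    - (m · 1# * (suc n · 1#))   ≈⟨ -‿distribʳ-* _ _ ⟩
    m · 1# * - (suc n · 1#)     ∎

  *-homo : ∀ i j → ⟦ i ℤ.* j ⟧ℤ ≈ ⟦ i ⟧ℤ * ⟦ j ⟧ℤ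
  *-homo (+ m)    j = *-homo⁺ m j
  *-homo -[1+ m ] j = begin
    ⟦ -[1+ m ] ℤ.* j ⟧ℤ         ≡⟨ ≡.cong ⟦_⟧ℤ (ℤₚ.neg-distribˡ-* (+ suc m) j) ⟨
    ⟦ ℤ.- (+ suc m ℤ.* j) ⟧ℤ    ≈⟨ neg-homo (+ suc m ℤ.* j) ⟩
    - ⟦ + suc m ℤ.* j ⟧ℤ        ≈⟨ -‿cong (*-homo⁺ (suc m) j) ⟩
    - (suc m · 1# * ⟦ j ⟧ℤ)     ≈⟨ -‿distribˡ-* _ _ ⟩
    - (suc m · 1#) * ⟦ j ⟧ℤ     ∎

  homomorphism : ℤ.+-*-rawRing -Raw-AlmostCommutative⟶ fromCommutativeRing R
  homomorphism = record
    { ⟦_⟧    = ⟦_⟧ℤ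
    ; +-homo = +-homo
    ; *-homo = *-homo
    ; -‿homo = neg-homo
    ; 0-homo = refl
    ; 1-homo = refl
    }

  open RingSolver ℤ.+-*-rawRing (fromCommutativeRing R) homomorphism
    (λ i j → Maybe.map (λ i≡j → reflexive (≡.cong ⟦_⟧ℤ i≡j)) (dec⇒maybe (i ℤₚ.≟ j))) public

module SignedSums {c ℓ} (R : CommutativeRing c ℓ) where
  open CommutativeRing R hiding (zero)
  open Sums R
  open RingProperties ring using (-1*x≈-x)
  open IntegerCoefficients R using (solve; _:+_; _:*_; _:-_; :-_; _:=_; con)
  open SemiringSum semiring using (sum; sum-cong-≋; sum-permute; *-distribˡ-sum)
  open FinSum *-commutativeMonoid using ()
    renaming ( sum to product; sum-cong-≋ to product-cong
             ; sum-replicate-zero to product-ones; sum-permute to product-permute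
             ; sum-remove to product-remove; ∑-distrib-+ to product-distrib-* )
  open SetoidReasoning setoid
  private
    module ∑ = ListFold +-commutativeMonoid
    module ∏ = ListFold *-commutativeMonoid

  -- Alternating sums.

  alternating : (Fin n → Carrier) → Carrier
  alternating {zero}  f = 0#
  alternating {suc n} f = f zero - alternating (f ∘ suc)

  -‿cong₂ : ∀ {a b c d} → a ≈ b → c ≈ d → a - c ≈ b - d
  -‿cong₂ p q = +-cong p (-‿cong q)

  alternating-cong : {f g : Fin n → Carrier} → (∀ i → f i ≈ g i) →
                     alternating f ≈ alternating g
  alternating-cong {zero}  eq = refl
  alternating-cong {suc n} eq = -‿cong₂ (eq zero) (alternating-cong (eq ∘ suc))

  alternating-- : (f g : Fin n → Carrier) →
                  alternating (λ i → f i - g i) ≈ alternating f - alternating g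
  alternating-- {zero}  f g = sym (-‿inverseʳ 0#)
  alternating-- {suc n} f g = trans (+-congˡ (-‿cong (alternating-- (f ∘ suc) (g ∘ suc)))) (lem _ _ _ _)
    where
    lem : ∀ a b s t → a - b - (s - t) ≈ a - s - (b - t)
    lem = solve 4 (λ a b s t → a :- b :- (s :- t) := a :- s :- (b :- t)) refl

  *-distribˡ-alternating : ∀ a (f : Fin n → Carrier) →
                           alternating (λ i → a * f i) ≈ a * alternating f
  *-distribˡ-alternating {zero}  a f = sym (zeroʳ a)
  *-distribˡ-alternating {suc n} a f =
    trans (+-congˡ (-‿cong (*-distribˡ-alternating a (f ∘ suc)))) (lem a _ _)
    where
    lem : ∀ a s t → a * s - a * t ≈ a * (s - t)
    lem = solve 3 (λ a s t → a :* s :- a :* t := a :* (s :- t)) refl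

  sum-signs : (f : Fin n → Carrier) → sum (λ i → (- 1#) ^ toℕ i * f i) ≈ alternating f
  sum-signs {zero}  f = refl
  sum-signs {suc n} f = +-cong (*-identityˡ _) (begin
    sum (λ i → - 1# * (- 1#) ^ toℕ i * f (suc i))    ≈⟨ sum-cong-≋ (λ i → *-assoc (- 1#) ((- 1#) ^ toℕ i) (f (suc i))) ⟩
    sum (λ i → - 1# * ((- 1#) ^ toℕ i * f (suc i)))  ≈⟨ *-distribˡ-sum (- 1#) (λ i → (- 1#) ^ toℕ i * f (suc i)) ⟨
    - 1# * sum (λ i → (- 1#) ^ toℕ i * f (suc i))    ≈⟨ -1*x≈-x _ ⟩
    - sum (λ i → (- 1#) ^ toℕ i * f (suc i))         ≈⟨ -‿cong (sum-signs (f ∘ suc)) ⟩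
    - alternating (f ∘ suc)                          ∎)

  -- The indices code an ordered pair of distinct columns: the first column, then the rank of the
  -- second among the rest. Interchanging the columns leads from `inject₁ i`, `j` to `suc j`, `i`
  -- and flips the sign, as for a determinant with two equal rows. Each induction step cancels the
  -- pairs involving column 0.
  alternating-antisymmetric :
    (f : Fin (suc n) → Fin n → Carrier) →
    (∀ i j → toℕ i ℕ.≤ toℕ j → f (inject₁ i) j ≈ f (suc j) i) →
    alternating (λ i → alternating (f i)) ≈ 0#
  alternating-antisymmetric {zero}  f eq = -‿inverseʳ 0#
  alternating-antisymmetric {suc n} f eq = begin
    alternating (f zero) - alternating (λ i → f (suc i) zero - alternating (λ j → f (suc i) (suc j)))
      ≈⟨ -‿cong₂ (alternating-cong (λ j → eq zero j ℕ.z≤n))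
           (alternating-- (λ i → f (suc i) zero) (λ i → alternating (λ j → f (suc i) (suc j)))) ⟩
    a - (a - alternating (λ i → alternating (λ j → f (suc i) (suc j))))
      ≈⟨ +-congˡ (-‿cong (+-congˡ (-‿cong
           (alternating-antisymmetric (λ i j → f (suc i) (suc j)) (λ i j i≤j → eq (suc i) (suc j) (ℕ.s≤s i≤j)))))) ⟩
    a - (a - 0#)
      ≈⟨ lem a ⟩
    0# ∎
    where
    a = alternating (λ i → f (suc i) zero)
    lem : ∀ a → a - (a - 0#) ≈ 0#
    lem = solve 1 (λ a → a :- (a :- con (+ 0)) := con (+ 0)) refl

  -- Row expansions and their recursions.

  minWeight : Fin n → Carrier → Carrier
  minWeight zero    a = a
  minWeight (suc _) a = 1#

  -- The entry of the first row is a right-to-left minimum exactly when it lies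
  -- in the first of the remaining columns, whatever the other rows do.
  expansion : ∀ n → (Fin n → Carrier) → (Fin n → Fin n → Carrier) → Carrier
  expansion zero    x M = 1#
  expansion (suc n) x M = alternating λ c →
    minWeight c (x zero) * M zero c * expansion n (x ∘ suc) (λ i j → M (suc i) (punchIn c j))

  expansion-cong : ∀ n x (M N : Fin n → Fin n → Carrier) → (∀ i j → M i j ≈ N i j) →
                   expansion n x M ≈ expansion n x N
  expansion-cong zero    x M N eq = refl
  expansion-cong (suc n) x M N eq = alternating-cong λ c →
    *-cong (*-congˡ {minWeight c (x zero)} (eq zero c))
           (expansion-cong n (x ∘ suc) _ _ (λ i j → eq (suc i) (punchIn c j)))

  -- The zero on the diagonal removes permutations with a fixed point. The Boolean tests let a
  -- common shift of row and column vanish by computation.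
  excWeight : Carrier → ℕ → ℕ → Carrier
  excWeight a i c = if i <ᵇ c then a else if i ≡ᵇ c then 0# else 1#

  derangementSum : ∀ n (x y : Fin n → Carrier) → Carrier
  derangementSum n x y = expansion n x (λ i c → excWeight (y i) (toℕ i) (toℕ c))

  -- The rows are those after the first of an (n+1) × (n+1) array, whose first
  -- row carries the weight 1 in every column.
  freeRowSum : ∀ n (x y : Fin n → Carrier) → Carrier
  freeRowSum n x y = alternating {suc n} λ c →
    expansion n x (λ i j → excWeight (y i) (suc (toℕ i)) (toℕ (punchIn c j)))

  -- In the free row, column 0 leaves exactly the array of `derangementSum n`; this is the term to
  -- subtract, because the actual first row has weight 0 there.
  derangementSum-suc : ∀ n (x y : Fin (suc n) → Carrier) →
    derangementSum (suc n) x y ≈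
    y zero * (freeRowSum n (x ∘ suc) (y ∘ suc) - derangementSum n (x ∘ suc) (y ∘ suc))
  derangementSum-suc n x y = begin
    x zero * 0# * D - alternating (λ c → 1# * y zero * E c)
      ≈⟨ +-congˡ (-‿cong (*-distribˡ-alternating (1# * y zero) E)) ⟩
    x zero * 0# * D - 1# * y zero * alternating E
      ≈⟨ lem (x zero) (y zero) D (alternating E) ⟩
    y zero * (D - alternating E - D) ∎
    where
    D = derangementSum n (x ∘ suc) (y ∘ suc)
    E : Fin n → Carrier
    E c = expansion n (x ∘ suc) (λ i j → excWeight (y (suc i)) (suc (toℕ i)) (toℕ (punchIn (suc c) j)))
    lem : ∀ a b d e → a * 0# * d - 1# * b * e ≈ b * (d - e - d)
    lem = solve 4 (λ a b d e → a :* con (+ 0) :* d :- con (+ 1) :* b :* e := b :* (d :- e :- d)) refl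

  -- Once the columns 0 and 1 meet only rows below the second, they are
  -- interchangeable, and so are the first two rows outside these columns.
  freeRowSum-suc : ∀ n (x y : Fin (suc n) → Carrier) →
    freeRowSum (suc n) x y ≈ - x zero * freeRowSum n (x ∘ suc) (y ∘ suc)
  freeRowSum-suc zero x y = lem (x zero)
    where
    lem : ∀ a → a * 0# * 1# - 0# - (a * 1# * 1# - 0# - 0#) ≈ - a * (1# - 0#)
    lem = solve 1 (λ a →
      a :* con (+ 0) :* con (+ 1) :- con (+ 0) :- (a :* con (+ 1) :* con (+ 1) :- con (+ 0) :- con (+ 0))
        := :- a :* (con (+ 1) :- con (+ 0))) refl
  freeRowSum-suc n@(suc k) x y = begin
    T zero zero - alternating (λ d → T zero (suc d))
      - (T (suc zero) zero - alternating (λ d → T (suc zero) (suc d))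
         - alternating (λ c → T (suc (suc c)) zero
             - (T (suc (suc c)) (suc zero) - alternating (λ d → T (suc (suc c)) (suc (suc d))))))
      ≈⟨ -‿cong₂ (+-congˡ (-‿cong (alternating-cong first≈second))) (+-congˡ (-‿cong remaining)) ⟩
    T zero zero - P - (T (suc zero) zero - P - x zero * Q)
      -- `T zero zero` puts the second row on the diagonal and has a factor `0#`; the two copies of
      -- `P` have opposite signs.
      ≈⟨ lem (x zero) (D (suc zero) zero) (D zero zero) P Q ⟩
    -- Once column 0 is gone, rows and columns shift down together, and `D (suc c) zero` computes to
    -- the term of the smaller free row sum at `c`.
    - x zero * (D (suc zero) zero - Q) ∎
    where
    W : Fin (2 ℕ.+ n) → Fin (1 ℕ.+ n) → Fin n → Fin n → Carrier
    W c d i j = excWeight (y (suc i)) (2 ℕ.+ toℕ i) (toℕ (punchIn c (punchIn d j)))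
    D : Fin (2 ℕ.+ n) → Fin (1 ℕ.+ n) → Carrier
    D c d = expansion n (x ∘ suc) (W c d)
    -- The free row takes column `c` and the next row takes column `punchIn c d`.
    T : Fin (2 ℕ.+ n) → Fin (1 ℕ.+ n) → Carrier
    T c d = minWeight d (x zero) * excWeight (y zero) 1 (toℕ (punchIn c d)) * D c d
    P = alternating (λ d → T (suc zero) (suc d))
    Q = alternating (λ c → D (suc (suc c)) zero)

    -- The two arrays of remaining columns differ only in keeping column 1 or column 0, and both
    -- have weight `1#` in every later row.
    first≈second : ∀ d → T zero (suc d) ≈ T (suc zero) (suc d)
    first≈second d = *-congˡ (expansion-cong n (x ∘ suc) (W zero (suc d)) (W (suc zero) (suc d)) λ where
      i zero    → refl
      i (suc j) → refl)

    D-comm : ∀ i j → toℕ i ℕ.≤ toℕ j → D (inject₁ i) j ≈ D (suc j) i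
    D-comm i j i≤j = expansion-cong n (x ∘ suc) _ _ λ i′ l →
      reflexive (≡.cong (λ m → excWeight (y (suc i′)) (2 ℕ.+ toℕ i′) (toℕ m)) (punchIn-inject₁ i j l i≤j))

    -- For the second row, column 0 is the minimal value and yields `x zero`, column 1 is diagonal
    -- and yields 0, and the other columns are excedances yielding `y zero`.
    row : ∀ c → T (suc (suc c)) zero
             - (T (suc (suc c)) (suc zero) - alternating (λ d → T (suc (suc c)) (suc (suc d))))
          ≈ x zero * D (suc (suc c)) zero - - y zero * alternating (λ d → D (suc (suc c)) (suc (suc d)))
    row c = trans
      (+-congˡ (-‿cong (+-congˡ (-‿cong (*-distribˡ-alternating (1# * y zero) (λ d → D (suc (suc c)) (suc (suc d))))))))
      (eq (x zero) (y zero) (D (suc (suc c)) zero) (D (suc (suc c)) (suc zero)) _)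
      where
      eq : ∀ a b p q r → a * 1# * p - (1# * 0# * q - 1# * b * r) ≈ a * p - - b * r
      eq = solve 5 (λ a b p q r →
        a :* con (+ 1) :* p :- (con (+ 1) :* con (+ 0) :* q :- con (+ 1) :* b :* r)
          := a :* p :- :- b :* r) refl

    remaining : alternating (λ c → T (suc (suc c)) zero
             - (T (suc (suc c)) (suc zero) - alternating (λ d → T (suc (suc c)) (suc (suc d)))))
          ≈ x zero * Q
    remaining = begin
      _ ≈⟨ alternating-cong row ⟩
      _ ≈⟨ alternating-- (λ c → x zero * D (suc (suc c)) zero)
                         (λ c → - y zero * alternating (λ d → D (suc (suc c)) (suc (suc d)))) ⟩
      _ ≈⟨ -‿cong₂ (*-distribˡ-alternating (x zero) (λ c → D (suc (suc c)) zero))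
                   (*-distribˡ-alternating (- y zero) (λ c → alternating (λ d → D (suc (suc c)) (suc (suc d))))) ⟩
      x zero * Q - - y zero * alternating (λ c → alternating (λ d → D (suc (suc c)) (suc (suc d))))
        ≈⟨ +-congˡ (-‿cong (*-congˡ (alternating-antisymmetric
             (λ c d → D (suc (suc c)) (suc (suc d)))
             (λ i j i≤j → D-comm (suc (suc i)) (suc (suc j)) (ℕ.s≤s (ℕ.s≤s i≤j)))))) ⟩
      x zero * Q - - y zero * 0#
        ≈⟨ eq (x zero) (y zero) Q ⟩
      x zero * Q ∎
      where
      eq : ∀ a b q → a * q - - b * 0# ≈ a * q
      eq = solve 3 (λ a b q → a :* q :- :- b :* con (+ 0) := a :* q) refl

    lem : ∀ a d e p q → a * 0# * e - p - (a * 1# * d - p - a * q) ≈ - a * (d - q)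
    lem = solve 5 (λ a d e p q →
      a :* con (+ 0) :* e :- p :- (a :* con (+ 1) :* d :- p :- a :* q) := :- a :* (d :- q)) refl

  freeRowSum≈product : ∀ n (x y : Fin n → Carrier) →
    freeRowSum n x y ≈ (- 1#) ^ n * product x
  freeRowSum≈product zero    x y = lem
    where
    lem : 1# - 0# ≈ 1# * 1#
    lem = solve 0 (con (+ 1) :- con (+ 0) := con (+ 1) :* con (+ 1)) refl
  freeRowSum≈product (suc n) x y =
    trans (freeRowSum-suc n x y) (trans (*-congˡ (freeRowSum≈product n (x ∘ suc) (y ∘ suc))) (lem _ _ _))
    where
    lem : ∀ a b p → - a * (b * p) ≈ - 1# * b * (a * p)
    lem = solve 3 (λ a b p → :- a :* (b :* p) := :- con (+ 1) :* b :* (a :* p)) refl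

  -- Products over segments and the closed form.

  *-distribˡ-sumOver : ∀ {a} {A : Set a} b (xs : List A) f →
    sumOver xs (λ z → b * f z) ≈ b * sumOver xs f
  *-distribˡ-sumOver b []       f = sym (zeroʳ b)
  *-distribˡ-sumOver b (z ∷ xs) f = trans (+-congˡ (*-distribˡ-sumOver b xs f)) (sym (distribˡ b _ _))

  product-zero : ∀ (f : Fin n → Carrier) i → f i ≈ 0# → product f ≈ 0#
  product-zero {suc n} f i eq = trans (product-remove {i = i} f) (trans (*-congʳ eq) (zeroˡ _))

  splitProduct : ∀ n (u v : Fin n → Carrier) → ℕ → Carrier
  splitProduct n u v j = (∏[ i ← atMost n j ] u i) * (∏[ i ← above n j ] v i)

  splitProduct-zero : ∀ n (u v : Fin n → Carrier) → splitProduct n u v 0 ≈ product v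
  splitProduct-zero n u v = begin
    splitProduct n u v 0               ≈⟨ *-cong (∏.fold-filter-allFin _ u) (∏.fold-filter-allFin _ v) ⟩
    product {n} (λ _ → 1#) * product v ≈⟨ *-congʳ (product-ones n) ⟩
    1# * product v                     ≈⟨ *-identityˡ _ ⟩
    product v                          ∎

  splitProduct-suc : ∀ n (u v : Fin (suc n) → Carrier) j →
    splitProduct (suc n) u v (suc j) ≈ u zero * splitProduct n (u ∘ suc) (v ∘ suc) j
  splitProduct-suc n u v j = begin
    splitProduct (suc n) u v (suc j)
      ≈⟨ *-cong (∏.fold-filter-allFin (λ i → toℕ i ℕ.<? suc j) u)
                (∏.fold-filter-allFin (λ i → suc j ℕ.≤? toℕ i) v) ⟩
    u zero * U * (1# * V)
      ≈⟨ trans (*-assoc _ _ _) (*-congˡ (*-congˡ (*-identityˡ _))) ⟩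
    u zero * (U * V)
      ≈⟨ *-congˡ (*-cong (∏.fold-filter-allFin _ (u ∘ suc))
           (trans (∏.fold-filter-allFin _ (v ∘ suc)) (product-cong {n} λ i →
             reflexive (≡.cong (λ b → if b then v (suc i) else 1#) (≤ᵇ-suc j (toℕ i)))))) ⟨
    u zero * splitProduct n (u ∘ suc) (v ∘ suc) j ∎
    where
    -- The two tests reduce to the same Boolean only after a split on `k`.
    ≤ᵇ-suc : ∀ k i → (k ℕ.≤ᵇ i) ≡ (suc k ℕ.≤ᵇ suc i)
    ≤ᵇ-suc zero    i = ≡.refl
    ≤ᵇ-suc (suc k) i = ≡.refl
    U = product {n} (λ i → if does (toℕ i ℕ.<? j) then u (suc i) else 1#)
    V = product {n} (λ i → if does (suc j ℕ.≤? suc (toℕ i)) then v (suc i) else 1#)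

  sumOver-1⋯ : ∀ m f → sumOver (1⋯ m) f ≡ sum {m} (λ i → f (suc (toℕ i)))
  sumOver-1⋯ m f = ≡.trans (∑.fold-map suc (upTo m) f) (go m (f ∘ suc) id)
    where
    go : ∀ m f g → sumOver (applyUpTo g m) f ≡ sum {m} (λ i → f (g (toℕ i)))
    go zero    f g = ≡.refl
    go (suc m) f g = ≡.cong (λ z → f (g 0) + z) (go m f (g ∘ suc))

  -- In the recursion the free row sum supplies the summand `j = 1`, and the factor `y zero` moves
  -- each old summand from `j` to `j + 1`; both parts carry the sign of `(- 1#) ^ suc m`.
  derangementSum-closed : ∀ m (x y : Fin (suc m) → Carrier) →
    derangementSum (suc m) x y ≈ (- 1#) ^ m * sumOver (1⋯ m) (splitProduct (suc m) y x)
  -- The free row sum and the derangement sum over no rows both equal 1 and cancel, in accordance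
  -- with the empty sum.
  derangementSum-closed zero    x y = trans (derangementSum-suc 0 x y) (eq (y zero))
    where
    eq : ∀ a → a * (1# - 0# - 1#) ≈ 1# * 0#
    eq = solve 1 (λ a → a :* (con (+ 1) :- con (+ 0) :- con (+ 1)) := con (+ 1) :* con (+ 0)) refl
  derangementSum-closed (suc m) x y = begin
    derangementSum (2 ℕ.+ m) x y
      ≈⟨ derangementSum-suc (suc m) x y ⟩
    y zero * (freeRowSum (suc m) x′ y′ - derangementSum (suc m) x′ y′)
      ≈⟨ *-congˡ (-‿cong₂ (freeRowSum≈product (suc m) x′ y′) (derangementSum-closed m x′ y′)) ⟩
    y zero * (- 1# * s * product x′ - s * S)
      ≈⟨ eq (y zero) s (product x′) S ⟩
    - 1# * s * (y zero * product x′ + y zero * S)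
      ≈⟨ *-congˡ (+-cong
           (trans (splitProduct-suc (suc m) y x 0) (*-congˡ (splitProduct-zero (suc m) y′ x′)))
           (trans (sum-cong-≋ {m} (λ i → splitProduct-suc (suc m) y x (suc (toℕ i))))
             (trans (sym (*-distribˡ-sum {m} (y zero) _))
               (*-congˡ (reflexive (≡.sym (sumOver-1⋯ m _))))))) ⟨
    - 1# * s * sum {suc m} (λ i → splitProduct (2 ℕ.+ m) y x (suc (toℕ i)))
      ≡⟨ ≡.cong (λ z → - 1# * s * z) (sumOver-1⋯ (suc m) _) ⟨
    - 1# * s * sumOver (1⋯ suc m) (splitProduct (2 ℕ.+ m) y x) ∎
    where
    x′ = x ∘ suc
    y′ = y ∘ suc
    s = (- 1#) ^ m
    S = sumOver (1⋯ m) (splitProduct (suc m) y′ x′)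
    eq : ∀ a s p q → a * (- 1# * s * p - s * q) ≈ - 1# * s * (a * p + a * q)
    eq = solve 4 (λ a s p q →
      a :* (:- con (+ 1) :* s :* p :- s :* q) := :- con (+ 1) :* s :* (a :* p :+ a :* q)) refl

  -- Signs and weights of permutations.

  -- As a product over all pairs, the sign can be reindexed by a permutation and split at position
  -- 0.
  sign : Permutation′ n → Carrier
  sign π = product λ i → product λ j → if does (inversion? π (i , j)) then - 1# else 1#

  sign≈^inv : (π : Permutation′ n) → (- 1#) ^ inv π ≈ sign π
  sign≈^inv {n} π = begin
    (- 1#) ^ inv π
      ≈⟨ power (filter (inversion? π) (cartesianProduct (allFin n) (allFin n))) ⟩
    (∏[ _ ← filter (inversion? π) (cartesianProduct (allFin n) (allFin n)) ] - 1#)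
      ≈⟨ ∏.fold-filter (inversion? π) (cartesianProduct (allFin n) (allFin n)) _ ⟩
    (∏[ p ← cartesianProduct (allFin n) (allFin n) ] (if does (inversion? π p) then - 1# else 1#))
      ≈⟨ ∏.fold-cartesianProductWith _,_ (allFin n) (allFin n) _ ⟩
    (∏[ i ← allFin n ] ∏[ j ← allFin n ] (if does (inversion? π (i , j)) then - 1# else 1#))
      ≡⟨ ∏.fold-allFin n (λ i → ∏[ j ← allFin n ] (if does (inversion? π (i , j)) then - 1# else 1#)) ⟩
    product (λ i → ∏[ j ← allFin n ] (if does (inversion? π (i , j)) then - 1# else 1#))
      ≈⟨ product-cong {n} (λ i → reflexive (∏.fold-allFin n (λ j → if does (inversion? π (i , j)) then - 1# else 1#))) ⟩
    sign π ∎
    where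
    power : ∀ {a} {A : Set a} (xs : List A) → (- 1#) ^ length xs ≈ (∏[ _ ← xs ] - 1#)
    power []       = refl
    power (_ ∷ xs) = *-congˡ (power xs)

  -- The first entry `c` forms inversions with exactly the `c` smaller values, wherever π puts them;
  -- hence the reindexing by π. Among the other entries `punchIn c` preserves inversions.
  sign-insert : ∀ c (π : Permutation′ n) → sign (insert zero c π) ≈ (- 1#) ^ toℕ c * sign π
  sign-insert {n} c π = *-cong
    (begin
      1# * product (λ j → below (punchIn c (π ⟨$⟩ʳ j)))  ≈⟨ *-identityˡ _ ⟩
      product (λ j → below (punchIn c (π ⟨$⟩ʳ j)))       ≈⟨ product-permute (below ∘ punchIn c) π ⟨
      product (below ∘ punchIn c)                         ≈⟨ firstRow c ⟩
      (- 1#) ^ toℕ c                                      ∎)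
    (product-cong λ i → trans (*-identityˡ _) (product-cong λ j → reflexive
      (≡.cong (λ b → if does (i <? j) ∧ b then - 1# else 1#)
        (does-⇔ (punchIn-<⇔ c (π ⟨$⟩ʳ j) (π ⟨$⟩ʳ i)) (_ <? _) (_ <? _)))))
    where
    below : Fin (suc n) → Carrier
    below d = if does (d <? c) then - 1# else 1#
    firstRow : ∀ {n} (c : Fin (suc n)) →
      product (λ j → if does (punchIn c j <? c) then - 1# else 1#) ≈ (- 1#) ^ toℕ c
    firstRow {n}     zero    = product-ones n
    firstRow {suc n} (suc c) = *-congˡ (firstRow c)

  minFactor : (Fin n → Carrier) → Permutation′ n → Fin n → Carrier
  minFactor x π i = if does (rightToLeftMin? π i) then x i else 1#

  weight : (x : Fin n → Carrier) (M : Fin n → Fin n → Carrier) → Permutation′ n → Carrier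
  weight x M π = sign π * product (λ i → minFactor x π i * M i (π ⟨$⟩ʳ i))

  minFactor-insert-zero : ∀ x c (π : Permutation′ n) →
    minFactor x (insert zero c π) zero ≡ minWeight c (x zero)
  minFactor-insert-zero x zero π = ≡.cong (λ b → if b then x zero else 1#)
    (dec-true (rightToLeftMin? (insert zero zero π) zero) λ { (suc j) _ → ℕ.s≤s ℕ.z≤n })
  minFactor-insert-zero {suc n} x (suc c) π = ≡.cong (λ b → if b then x zero else 1#)
    (dec-false (rightToLeftMin? (insert zero (suc c) π) zero) λ m →
      -- The witness is the later position at which the value 0 occurs.
      contradiction (≡.subst (λ d → suc c < punchIn (suc c) d) (Perm.inverseʳ π {zero})
                       (m (suc (π ⟨$⟩ˡ zero)) (ℕ.s≤s ℕ.z≤n))) λ ())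

  weight-insert : ∀ x M c (π : Permutation′ n) →
    weight x M (insert zero c π) ≈
    (- 1#) ^ toℕ c * (minWeight c (x zero) * M zero c) *
      weight (x ∘ suc) (λ i j → M (suc i) (punchIn c j)) π
  weight-insert x M c π = trans
    (*-cong (sign-insert c π)
      (*-cong (*-congʳ (reflexive (minFactor-insert-zero x c π)))
        (product-cong λ i → *-congʳ (reflexive (≡.cong (λ b → if b then x (suc i) else 1#)
          (does-⇔ (rightToLeftMin-insert c π i) (rightToLeftMin? (insert zero c π) (suc i)) (rightToLeftMin? π i)))))))
    (eq _ _ _ _)
    where
    eq : ∀ s t a b → s * t * (a * b) ≈ s * a * (t * b)
    eq = solve 4 (λ s t a b → s :* t :* (a :* b) := s :* a :* (t :* b)) refl

  -- `permutations` inserts a first entry just as `expansion` picks a column for the first row, and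
  -- `weight-insert` matches the two recursions term by term.
  sum-weights : ∀ n x M → sumOver (permutations n) (weight x M) ≈ expansion n x M
  sum-weights zero    x M = trans (+-identityʳ _) (*-identityˡ _)
  sum-weights (suc n) x M = begin
    sumOver (permutations (suc n)) (weight x M)
      ≈⟨ ∑.fold-cartesianProductWith (insert zero) (allFin (suc n)) (permutations n) (weight x M) ⟩
    (∑[ c ← allFin (suc n) ] ∑[ π ← permutations n ] weight x M (insert zero c π))
      ≡⟨ ∑.fold-allFin (suc n) (λ c → ∑[ π ← permutations n ] weight x M (insert zero c π)) ⟩
    sum (λ c → ∑[ π ← permutations n ] weight x M (insert zero c π))
      ≈⟨ sum-cong-≋ row ⟩
    sum (λ c → (- 1#) ^ toℕ c * (minWeight c (x zero) * M zero c * E c))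
      ≈⟨ sum-signs (λ c → minWeight c (x zero) * M zero c * E c) ⟩
    expansion (suc n) x M ∎
    where
    E : Fin (suc n) → Carrier
    E c = expansion n (x ∘ suc) (λ i j → M (suc i) (punchIn c j))
    row : ∀ c → (∑[ π ← permutations n ] weight x M (insert zero c π)) ≈
                (- 1#) ^ toℕ c * (minWeight c (x zero) * M zero c * E c)
    row c = begin
      (∑[ π ← permutations n ] weight x M (insert zero c π))
        ≈⟨ ∑.fold-cong (permutations n) (weight-insert x M c) ⟩
      _ ≈⟨ *-distribˡ-sumOver _ (permutations n) _ ⟩
      (- 1#) ^ toℕ c * (minWeight c (x zero) * M zero c) * _
        ≈⟨ *-congˡ (sum-weights n (x ∘ suc) _) ⟩
      (- 1#) ^ toℕ c * (minWeight c (x zero) * M zero c) * E c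
        ≈⟨ *-assoc _ _ _ ⟩
      (- 1#) ^ toℕ c * (minWeight c (x zero) * M zero c * E c) ∎

  -- Derangements as weighted permutations.

  excFactor : (Fin n → Carrier) → Permutation′ n → Fin n → Carrier
  excFactor y π i = if does (i <? π ⟨$⟩ʳ i) then y i else 1#

  excWeight-≢ : ∀ a {i c} → i ≢ c → excWeight a i c ≡ (if does (i ℕ.<? c) then a else 1#)
  excWeight-≢ a {i} {c} i≢c rewrite dec-false (i ℕ.≟ c) i≢c = ≡.refl

  excWeight-≡ : ∀ a i → excWeight a i i ≡ 0#
  excWeight-≡ a zero    = ≡.refl
  excWeight-≡ a (suc i) = excWeight-≡ a i

  derangementWeight : (x y : Fin n → Carrier) → Permutation′ n → Carrier
  derangementWeight x y = weight x (λ i c → excWeight (y i) (toℕ i) (toℕ c))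

  -- Off the diagonal `excWeight` only detects excedances; a fixed point contributes a zero factor,
  -- which takes over the task of the filter.
  derangementWeight-correct : (x y : Fin n → Carrier) (π : Permutation′ n) →
    (if does (derangement? π)
     then (- 1#) ^ inv π * (∏[ i ← RLMi π ] x i) * (∏[ i ← EXCi π ] y i) else 0#) ≈
    derangementWeight x y π
  derangementWeight-correct x y π = byCases (derangement? π)
    where
    byCases : (d? : Dec (Derangement π)) →
      (if does d? then (- 1#) ^ inv π * (∏[ i ← RLMi π ] x i) * (∏[ i ← EXCi π ] y i) else 0#) ≈
      derangementWeight x y π
    byCases (yes d) = begin
      (- 1#) ^ inv π * (∏[ i ← RLMi π ] x i) * (∏[ i ← EXCi π ] y i)
        ≈⟨ *-cong (*-cong (sign≈^inv π) (∏.fold-filter-allFin (rightToLeftMin? π) x))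
                  (∏.fold-filter-allFin (λ j → j <? π ⟨$⟩ʳ j) y) ⟩
      sign π * product (minFactor x π) * product (excFactor y π)
        ≈⟨ *-assoc _ _ _ ⟩
      sign π * (product (minFactor x π) * product (excFactor y π))
        ≈⟨ *-congˡ (product-distrib-* (minFactor x π) (excFactor y π)) ⟨
      sign π * product (λ i → minFactor x π i * excFactor y π i)
        ≈⟨ *-congˡ (product-cong λ i → *-congˡ {minFactor x π i} (reflexive
             (excWeight-≢ (y i) (λ eq → d i (≡.sym (toℕ-injective eq)))))) ⟨
      derangementWeight x y π ∎
    byCases (no ¬d) with ¬∀⟶∃¬ _ _ (λ i → ¬? (π ⟨$⟩ʳ i ≟ i)) ¬d
    ... | i , fixed = sym (trans (*-congˡ (product-zero _ i zeroAt)) (zeroʳ _))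
      where
      zeroAt : minFactor x π i * excWeight (y i) (toℕ i) (toℕ (π ⟨$⟩ʳ i)) ≈ 0#
      zeroAt = trans (*-congˡ (reflexive (≡.trans
        (≡.cong (λ j → excWeight (y i) (toℕ i) (toℕ j)) (decidable-stable (π ⟨$⟩ʳ i ≟ i) fixed))
        (excWeight-≡ (y i) (toℕ i))))) (zeroʳ _)

  -- The variables may depend on π because, in the identity for values, position `i` carries the
  -- variables with index `π ⟨$⟩ʳ i`.
  sum-derangements : ∀ n (x y : Permutation′ n → Fin n → Carrier) →
    (∑[ π ← derangements n ] ((- 1#) ^ inv π * (∏[ i ← RLMi π ] x π i) * (∏[ i ← EXCi π ] y π i))) ≈
    (∑[ π ← permutations n ] derangementWeight (x π) (y π) π)
  sum-derangements n x y = trans (∑.fold-filter derangement? (permutations n) _)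
    (∑.fold-cong (permutations n) λ π → derangementWeight-correct (x π) (y π) π)

  sum-derangementWeights : ∀ m (x y : Fin (suc m) → Carrier) →
    (∑[ π ← permutations (suc m) ] derangementWeight x y π) ≈
    (- 1#) ^ m * (∑[ j ← 1⋯ m ] splitProduct (suc m) y x j)
  sum-derangementWeights m x y = trans
    (sum-weights (suc m) x (λ i c → excWeight (y i) (toℕ i) (toℕ c))) (derangementSum-closed m x y)

  -- Effect of the reflection on weights and segments.

  derangementWeight-cong : ∀ (x y : Fin n → Carrier) π ρ → π Perm.≈ ρ →
                           derangementWeight x y π ≈ derangementWeight x y ρ
  derangementWeight-cong {n} x y π ρ π≈ρ = *-cong
    (product-cong λ i → product-cong λ j → reflexive
      (≡.cong₂ (λ k l → if does (i <? j) ∧ does (l <? k) then - 1# else 1#) (π≈ρ i) (π≈ρ j)))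
    (product-cong λ i → *-cong
      (reflexive (≡.cong (λ b → if b then x i else 1#)
        (does-⇔ (mk⇔ (transport π ρ π≈ρ i) (transport ρ π (≡.sym ∘ π≈ρ) i)) (rightToLeftMin? π i) (rightToLeftMin? ρ i))))
      (reflexive (≡.cong (λ c → excWeight (y i) (toℕ i) (toℕ c)) (π≈ρ i))))
    where
    transport : ∀ (π ρ : Permutation′ n) → π Perm.≈ ρ → ∀ i → RightToLeftMin π i → RightToLeftMin ρ i
    transport π ρ π≈ρ i m j i<j = ≡.subst₂ _<_ (π≈ρ i) (π≈ρ j) (m j i<j)

  -- The reflection preserves the diagonal and each of its two sides.
  excWeight-opposite : ∀ b (i c : Fin n) →
    excWeight b (toℕ (opposite c)) (toℕ (opposite i)) ≡ excWeight b (toℕ i) (toℕ c)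
  excWeight-opposite b i c = ≡.cong₂ (λ p q → if p then b else if q then 0# else 1#)
    (does-⇔ (opposite-<⇔ c i) (opposite c <? opposite i) (i <? c))
    (does-⇔ (mk⇔ (λ eq → ≡.cong toℕ (≡.sym (opposite-injective (toℕ-injective eq))))
                 (λ eq → ≡.cong (toℕ ∘ opposite) (≡.sym (toℕ-injective eq))))
            (toℕ (opposite c) ℕ.≟ toℕ (opposite i)) (toℕ i ℕ.≟ toℕ c))
    where
    opposite-injective : ∀ {i j : Fin n} → opposite i ≡ opposite j → i ≡ j
    opposite-injective eq =
      ≡.trans (≡.sym (opposite-involutive _)) (≡.trans (≡.cong opposite eq) (opposite-involutive _))

  -- Both products are reindexed by `reversed`: the point at `a` moves to position
  -- `opposite (π ⟨$⟩ʳ a)`, where the reversed variables have index `π ⟨$⟩ʳ a`.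
  derangementWeight-antitranspose : ∀ (x y : Fin n → Carrier) π →
    derangementWeight (x ∘ opposite) (y ∘ opposite) (antitranspose π) ≈
    derangementWeight (x ∘ (π ⟨$⟩ʳ_)) (y ∘ (π ⟨$⟩ʳ_)) π
  derangementWeight-antitranspose x y π = *-cong
    (begin
      product (λ i → product (s i))
        ≈⟨ product-permute (λ i → product (s i)) reversed ⟩
      product (λ a → product (s (reversed ⟨$⟩ʳ a)))
        ≈⟨ product-cong (λ a → product-permute (s (reversed ⟨$⟩ʳ a)) reversed) ⟩
      product (λ a → product (λ b → s (reversed ⟨$⟩ʳ a) (reversed ⟨$⟩ʳ b)))
        ≈⟨ product-cong (λ a → product-cong (λ b → reflexive (≡.cong (λ c → if c then - 1# else 1#)
             (does-⇔ (inversion⇔ a b)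
               (inversion? (antitranspose π) (reversed ⟨$⟩ʳ a , reversed ⟨$⟩ʳ b)) (inversion? π (a , b)))))) ⟩
      sign π ∎)
    (begin
      product t
        ≈⟨ product-permute t reversed ⟩
      product (λ a → t (reversed ⟨$⟩ʳ a))
        ≈⟨ product-cong (λ a → *-cong
             (reflexive (≡.cong₂ (λ c z → if c then z else 1#)
               (does-⇔ (rightToLeftMin⇔ a) (rightToLeftMin? (antitranspose π) (reversed ⟨$⟩ʳ a)) (rightToLeftMin? π a))
               (≡.cong x (opposite-involutive _))))
             (reflexive (≡.trans
               (≡.cong₂ (λ z c → excWeight z (toℕ (reversed ⟨$⟩ʳ a)) (toℕ c)) (≡.cong y (opposite-involutive _)) (image a))
               (excWeight-opposite (y (π ⟨$⟩ʳ a)) a (π ⟨$⟩ʳ a))))) ⟩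
      _ ∎)
    where
    open Antitranspose π
    s : Fin _ → Fin _ → Carrier
    s i j = if does (inversion? (antitranspose π) (i , j)) then - 1# else 1#
    t : Fin _ → Carrier
    t i = minFactor (x ∘ opposite) (antitranspose π) i *
          excWeight (y (opposite i)) (toℕ i) (toℕ (antitranspose π ⟨$⟩ʳ i))

  -- Reversal carries the first `j` indices to the last `j`, the complement of the first `j′`, so
  -- `u` and `v` trade places.
  splitProduct-opposite : ∀ n (u v : Fin n → Carrier) j j′ → j ℕ.+ j′ ≡ n →
    splitProduct n (u ∘ opposite) (v ∘ opposite) j ≈ splitProduct n v u j′
  splitProduct-opposite n u v j j′ j+j′≡n = begin
    splitProduct n (u ∘ opposite) (v ∘ opposite) j
      ≈⟨ *-cong (∏.fold-filter-allFin (λ i → toℕ i ℕ.<? j) (u ∘ opposite))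
                (∏.fold-filter-allFin (λ i → j ℕ.≤? toℕ i) (v ∘ opposite)) ⟩
    product f * product g
      ≈⟨ *-cong (product-permute f reverse) (product-permute g reverse) ⟩
    product (f ∘ opposite) * product (g ∘ opposite)
      ≈⟨ *-cong
           (product-cong λ i → reflexive (≡.cong₂ (λ b k → if b then u k else 1#)
             (does-⇔ (complementary-<⇔≤ (≡.trans (opposite-+ i) (≡.sym j+j′≡n)))
               (toℕ (opposite i) ℕ.<? j) (j′ ℕ.≤? toℕ i))
             (opposite-involutive i)))
           (product-cong λ i → reflexive (≡.sym (≡.cong₂ (λ b k → if b then v k else 1#)
             (does-⇔ (complementary-<⇔≤ (opposite-+′ i))
               (toℕ i ℕ.<? j′) (j ℕ.≤? toℕ (opposite i)))
             (≡.sym (opposite-involutive i))))) ⟩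
    product (λ i → if does (j′ ℕ.≤? toℕ i) then u i else 1#) *
    product (λ i → if does (toℕ i ℕ.<? j′) then v i else 1#)
      ≈⟨ *-comm _ _ ⟩
    _ ≈⟨ *-cong (∏.fold-filter-allFin (λ i → toℕ i ℕ.<? j′) v)
                (∏.fold-filter-allFin (λ i → j′ ℕ.≤? toℕ i) u) ⟨
    splitProduct n v u j′ ∎
    where
    f g : Fin n → Carrier
    f i = if does (toℕ i ℕ.<? j) then u (opposite i) else 1#
    g i = if does (j ℕ.≤? toℕ i) then v (opposite i) else 1#
    opposite-+′ : ∀ i → toℕ i ℕ.+ suc (toℕ (opposite i)) ≡ j′ ℕ.+ j
    opposite-+′ i = ≡.trans (ℕₚ.+-comm (toℕ i) _) (≡.trans (≡.sym (ℕₚ.+-suc _ (toℕ i)))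
      (≡.trans (opposite-+ i) (≡.trans (≡.sym j+j′≡n) (ℕₚ.+-comm j j′))))

  -- The summand at `j` becomes the one at `suc m - j`; on `Fin m` this relabelling is the reversal,
  -- since the summands start at 1.
  sum-splitProduct-opposite : ∀ m (u v : Fin (suc m) → Carrier) →
    sumOver (1⋯ m) (splitProduct (suc m) (u ∘ opposite) (v ∘ opposite)) ≈
    sumOver (1⋯ m) (splitProduct (suc m) v u)
  sum-splitProduct-opposite m u v = begin
    sumOver (1⋯ m) (splitProduct (suc m) (u ∘ opposite) (v ∘ opposite))
      ≡⟨ sumOver-1⋯ m _ ⟩
    sum f
      ≈⟨ sum-permute f reverse ⟩
    sum (f ∘ opposite)
      ≈⟨ sum-cong-≋ {m} (λ k → splitProduct-opposite (suc m) u v (suc (toℕ (opposite k))) (suc (toℕ k)) (≡.cong suc (opposite-+ k))) ⟩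
    sum {m} (λ k → splitProduct (suc m) v u (suc (toℕ k)))
      ≡⟨ sumOver-1⋯ m _ ⟨
    sumOver (1⋯ m) (splitProduct (suc m) v u) ∎
    where
    f : Fin m → Carrier
    f k = splitProduct (suc m) (u ∘ opposite) (v ∘ opposite) (suc (toℕ k))

theorem22 : ∀ {c ℓ} (R : CommutativeRing c ℓ) (n : ℕ) .{{_ : NonZero n}} →
    let open CommutativeRing R
        open Sums R
    in (x y : Fin n → Carrier) →
      ((∑[ π ← derangements n ] ((- 1#) ^ inv π * (∏[ s ← RLMv π ] x s) * (∏[ s ← EXCv π ] y s)))
        ≈ (- 1#) ^ (n ∸ 1) * (∑[ j ← 1⋯ (n ∸ 1) ] ((∏[ i ← atMost n j ] x i) * (∏[ i ← above n j ] y i))))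
      ×
      ((∑[ π ← derangements n ] ((- 1#) ^ inv π * (∏[ s ← RLMi π ] x s) * (∏[ s ← EXCi π ] y s)))
        ≈ (- 1#) ^ (n ∸ 1) * (∑[ j ← 1⋯ (n ∸ 1) ] ((∏[ i ← atMost n j ] y i) * (∏[ i ← above n j ] x i))))
theorem22 R n@(suc m) x y = byValues , byIndices
  where
  open CommutativeRing R hiding (zero)
  open Sums R
  open SignedSums R
  module ∑ = ListFold +-commutativeMonoid
  module ∏ = ListFold *-commutativeMonoid
  open SetoidReasoning setoid

  byIndices = trans (sum-derangements n (λ _ → x) (λ _ → y)) (sum-derangementWeights m x y)

  byValues = begin
    (∑[ π ← derangements n ] ((- 1#) ^ inv π * (∏[ s ← RLMv π ] x s) * (∏[ s ← EXCv π ] y s)))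
      ≈⟨ ∑.fold-cong (derangements n) (λ π → *-cong
           (*-congˡ (reflexive (∏.fold-map (π ⟨$⟩ʳ_) (RLMi π) x)))
           (reflexive (∏.fold-map (π ⟨$⟩ʳ_) (EXCi π) y))) ⟩
    (∑[ π ← derangements n ] ((- 1#) ^ inv π * (∏[ i ← RLMi π ] x (π ⟨$⟩ʳ i)) * (∏[ i ← EXCi π ] y (π ⟨$⟩ʳ i))))
      ≈⟨ sum-derangements n (λ π i → x (π ⟨$⟩ʳ i)) (λ π i → y (π ⟨$⟩ʳ i)) ⟩
    (∑[ π ← permutations n ] derangementWeight (x ∘ (π ⟨$⟩ʳ_)) (y ∘ (π ⟨$⟩ʳ_)) π)
      ≈⟨ ∑.fold-cong (permutations n) (derangementWeight-antitranspose x y) ⟨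
    (∑[ π ← permutations n ] derangementWeight (x ∘ opposite) (y ∘ opposite) (antitranspose π))
      ≈⟨ ∑.fold-permutations antitranspose antitranspose-cong antitranspose-involutive
           (derangementWeight (x ∘ opposite) (y ∘ opposite))
           (derangementWeight-cong (x ∘ opposite) (y ∘ opposite)) ⟨
    (∑[ π ← permutations n ] derangementWeight (x ∘ opposite) (y ∘ opposite) π)
      ≈⟨ sum-derangementWeights m (x ∘ opposite) (y ∘ opposite) ⟩
    (- 1#) ^ m * sumOver (1⋯ m) (splitProduct n (y ∘ opposite) (x ∘ opposite))
      -- Undoing the reversal of the variables puts `x` on the initial segments and `y` on the final
      -- ones.
      ≈⟨ *-congˡ (sum-splitProduct-opposite m y x) ⟩
    (- 1#) ^ m * sumOver (1⋯ m) (splitProduct n x y) ∎
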